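{- Let $G$ be a framework for a $3$-connected matroid $M$ with $|E(M)|\ge 4$, and let $e$ be a loop-edge of $G$ at a vertex $v$. If $e\notin \mathrm{cl}_M(E(G-v))$, then the independent sets of $M$ are exactly the sets $I\subseteq E(G)$ such that $G[I]$ contains no balanced cycle and $|E(H)|\le |V(H)|$ for each component $H$ of $G[I]$.
   Context: For a graph $G$ and a vertex $v$, $\mathrm{loops}_G(v)$ denotes the set of loop-edges of $G$ at $v$. Graphs are finite and may have loops and parallel edges; a loop-edge forms a cycle of length one. For a set $X$ of edges, $G[X]$ is the subgraph of $G$ with edge-set $X$ and no isolated vertices. A graph $G$ is a framework for a matroid $M$ if (1) $E(G)=E(M)$; (2) $r_M(E(H))\le |V(H)|$ for each component $H$ of $G$; (3) for each vertex $v$ of $G$, $\mathrm{cl}_M(E(G-v))\subseteq E(G-v)\cup \mathrm{loops}_G(v)$; and (4) for each circuit $C$ of $M$, the subgraph $G[C]$ has at most two components. A cycle $C$ of $G$ is balanced (with respect to $M$) if $E(C)$ is a circuit of $M$. -}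

module Defs where

open import Data.Nat using (ℕ; zero; suc; _+_; _≤_; _<_)
open import Data.Fin using (Fin)
open import Data.Fin.Properties using (_≟_)
open import Data.Fin.Subset using (Subset; _∈_; _∉_; _⊆_; _⊂_; _∪_; _∩_; ∁; ⊤; ⁅_⁆; ∣_∣)
open import Data.Product using (Σ; ∃; _×_; _,_; proj₁; proj₂)
open import Data.Sum using (_⊎_)
open import Data.List using (List; map; sum)
open import Data.Fin using (toℕ)
open import Data.Vec.Functional using () renaming (foldr to vfoldr)
open import Relation.Nullary using (¬_; Dec; yes; no)
open import Relation.Binary.PropositionalEquality using (_≡_)
open import Function.Bundles using (_⇔_)
open import Data.Vec using (tabulate; lookup)

record Matroid (m : ℕ) : Set where
  field
    rank      : Subset m → ℕ
    rank-≤    : ∀ X → rank X ≤ ∣ X ∣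
    rank-mono : ∀ {X Y} → X ⊆ Y → rank X ≤ rank Y
    rank-sub  : ∀ X Y → rank (X ∪ Y) + rank (X ∩ Y) ≤ rank X + rank Y

module _ {m : ℕ} (M : Matroid m) where
  open Matroid M

  Independent : Subset m → Set
  Independent X = rank X ≡ ∣ X ∣

  Circuit : Subset m → Set
  Circuit C = ¬ Independent C × (∀ Y → Y ⊂ C → Independent Y)

  InClosure : Fin m → Subset m → Set
  InClosure e X = rank (X ∪ ⁅ e ⁆) ≡ rank X

  IsSeparation : ℕ → Subset m → Set
  IsSeparation k X = k ≤ ∣ X ∣ × k ≤ ∣ ∁ X ∣ × rank X + rank (∁ X) < rank ⊤ + k

  ThreeConnected : Set
  ThreeConnected = ∀ k → 1 ≤ k → k < 3 → ∀ X → ¬ IsSeparation k X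

-- Graphs with vertex set Fin n and edge set Fin m (loops and parallel
-- edges allowed); each edge has an (unordered) pair of ends.

record Graph (n m : ℕ) : Set where
  field
    ends : Fin m → Fin n × Fin n

module _ {n m : ℕ} (G : Graph n m) where
  open Graph G

  end₁ end₂ : Fin m → Fin n
  end₁ e = proj₁ (ends e)
  end₂ e = proj₂ (ends e)

  Inc : Fin m → Fin n → Set
  Inc e v = end₁ e ≡ v ⊎ end₂ e ≡ v

  IsLoopAt : Fin m → Fin n → Set
  IsLoopAt e v = end₁ e ≡ v × end₂ e ≡ v

  VertexOf : Subset m → Fin n → Set
  VertexOf X v = ∃ λ e → e ∈ X × Inc e v

  data Conn (X : Subset m) (u : Fin n) : Fin n → Set where
    here : Conn X u u
    fwd  : ∀ e → e ∈ X → Conn X u (end₁ e) → Conn X u (end₂ e)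
    bwd  : ∀ e → e ∈ X → Conn X u (end₂ e) → Conn X u (end₁ e)

  IsComponentAt : Subset m → Fin n → Subset n → Subset m → Set
  IsComponentAt X u S T =
    (∀ w → (w ∈ S) ⇔ Conn X u w) ×
    (∀ e → (e ∈ T) ⇔ (e ∈ X × Conn X u (end₁ e)))

  EdgesAvoiding : Fin n → Subset m
  EdgesAvoiding v = tabulate λ e → notInc (end₁ e) (end₂ e)
    where
      open import Data.Bool using (Bool; true; false; _∧_; not)
      open import Relation.Nullary.Decidable using (⌊_⌋)
      notInc : Fin n → Fin n → Bool
      notInc a b = not ⌊ a ≟ v ⌋ ∧ not ⌊ b ≟ v ⌋

  LoopsAt : Fin n → Subset m
  LoopsAt v = tabulate λ e → ⌊ end₁ e ≟ v ⌋ ∧ ⌊ end₂ e ≟ v ⌋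
    where
      open import Data.Bool using (_∧_)
      open import Relation.Nullary.Decidable using (⌊_⌋)

  -- degree of v in G[X] (a loop contributes 2)
  degree : Subset m → Fin n → ℕ
  degree X v = vfoldr _+_ 0 λ e → contrib (lookup X e) (end₁ e) (end₂ e)
    where
      open import Data.Bool using (Bool; true; false)
      open import Relation.Nullary.Decidable using (⌊_⌋)
      b2n : Bool → ℕ
      b2n true = 1
      b2n false = 0
      contrib : Bool → Fin n → Fin n → ℕ
      contrib false a b = 0
      contrib true a b = b2n ⌊ a ≟ v ⌋ + b2n ⌊ b ≟ v ⌋

  IsCycle : Subset m → Set
  IsCycle C =
    (∃ λ e → e ∈ C) ×
    (∀ u w → VertexOf C u → VertexOf C w → Conn C u w) ×
    (∀ v → degree C v ≡ 0 ⊎ degree C v ≡ 2)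

module _ {n m : ℕ} (G : Graph n m) (M : Matroid m) where
  open Matroid M

  -- G is a framework for M (condition (1), E(G) = E(M), is built in)
  IsFramework : Set
  IsFramework =
    (∀ u S T → IsComponentAt G ⊤ u S T → rank T ≤ ∣ S ∣) ×
    (∀ v e → InClosure M e (EdgesAvoiding G v) →
       e ∈ (EdgesAvoiding G v ∪ LoopsAt G v)) ×
    -- (4) for each circuit C, G[C] has at most two components
    (∀ C → Circuit M C → ∀ x y z →
       VertexOf G C x → VertexOf G C y → VertexOf G C z →
       Conn G C x y ⊎ Conn G C y z ⊎ Conn G C x z)

  NoBalancedCycle : Subset m → Set
  NoBalancedCycle I = ∀ C → C ⊆ I → IsCycle G C → ¬ Circuit M C

  ComponentsSparse : Subset m → Set
  ComponentsSparse I =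
    ∀ u S T → VertexOf G I u → IsComponentAt G I u S T → ∣ T ∣ ≤ ∣ S ∣

module Submission where

-- If I is independent, every component of G[I] has at most as many edges as vertices:
-- growing a connected subgraph along pendant edges raises the rank with each new vertex,
-- and r(E(H)) ≤ |V(H)| for the components H of G.
--
-- Conversely, a circuit C has minimum degree at least two in G[C]. If C is connected and
-- lies in a sparse set, then every vertex of G[C] has degree exactly two, so C is a balanced
-- cycle. A disconnected circuit cannot be reached from v, by the rank count at
-- split-unreachable; hence no circuit meets both the component of v and its complement.
-- As M is connected, that component contains every edge, so every circuit is connected.

open import Defs
open import Data.Nat using (ℕ; zero; suc; _+_; _≤_; _<_; z≤n; s≤s)
open import Data.Nat.Properties
open import Data.Nat.Solver using (module +-*-Solver)
open import Data.Bool using (Bool; true; false; _∧_; not; if_then_else_)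
open import Data.Fin using (Fin; zero; suc)
open import Data.Fin.Properties using (any?) renaming (_≟_ to _≟ᶠ_)
open import Data.Fin.Subset using (Subset; _∈_; _∉_; _⊆_; _∪_; _∩_; ∁; ⊤; ⊥; ⁅_⁆; ∣_∣)
open import Data.Fin.Subset.Properties
open import Data.Product using (∃; ∃₂; _×_; _,_; proj₁; proj₂)
open import Data.Sum using (_⊎_; inj₁; inj₂; [_,_]; swap)
open import Data.Vec using ([]; _∷_; lookup; tabulate)
open import Data.Vec.Properties using (lookup⇒[]=; []=⇒lookup; lookup∘tabulate)
open import Function using (_∘_; id)
open import Function.Bundles using (_⇔_; mk⇔; Equivalence)
open import Relation.Nullary using (¬_; Dec; yes; no; contradiction; ¬?; _×-dec_; _⊎-dec_)
open import Relation.Nullary.Decidable using (⌊_⌋; decidable-stable)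
open import Relation.Binary.PropositionalEquality using (_≡_; _≢_; refl; sym; trans; cong; cong₂; subst;
  module ≡-Reasoning)
open import Relation.Unary using (Decidable)
open import Algebra.Properties.CommutativeMonoid.Sum +-0-commutativeMonoid
  using (sum; sum-cong-≗; ∑-distrib-+; ∑-comm)

open Equivalence using (to; from)

private variable
  n m : ℕ

-- Subsets

∣p∪q∣+∣p∩q∣≡∣p∣+∣q∣ : (p q : Subset n) → ∣ p ∪ q ∣ + ∣ p ∩ q ∣ ≡ ∣ p ∣ + ∣ q ∣
∣p∪q∣+∣p∩q∣≡∣p∣+∣q∣ []          []          = refl
∣p∪q∣+∣p∩q∣≡∣p∣+∣q∣ (false ∷ p) (false ∷ q) = ∣p∪q∣+∣p∩q∣≡∣p∣+∣q∣ p q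
∣p∪q∣+∣p∩q∣≡∣p∣+∣q∣ (true  ∷ p) (false ∷ q) = cong suc (∣p∪q∣+∣p∩q∣≡∣p∣+∣q∣ p q)
∣p∪q∣+∣p∩q∣≡∣p∣+∣q∣ (false ∷ p) (true  ∷ q) =
  trans (cong suc (∣p∪q∣+∣p∩q∣≡∣p∣+∣q∣ p q)) (sym (+-suc ∣ p ∣ ∣ q ∣))
∣p∪q∣+∣p∩q∣≡∣p∣+∣q∣ (true  ∷ p) (true  ∷ q) = cong suc
  (trans (+-suc _ _) (trans (cong suc (∣p∪q∣+∣p∩q∣≡∣p∣+∣q∣ p q)) (sym (+-suc ∣ p ∣ ∣ q ∣))))

∣p∪q∣≤∣p∣+∣q∣ : (p q : Subset n) → ∣ p ∪ q ∣ ≤ ∣ p ∣ + ∣ q ∣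
∣p∪q∣≤∣p∣+∣q∣ p q = ≤-trans (m≤m+n _ _) (≤-reflexive (∣p∪q∣+∣p∩q∣≡∣p∣+∣q∣ p q))

∪-lub : {p q r : Subset n} → p ⊆ r → q ⊆ r → p ∪ q ⊆ r
∪-lub {p = p} {q} p⊆r q⊆r x∈ = [ p⊆r , q⊆r ] (x∈p∪q⁻ p q x∈)

∩-glb : {p q r : Subset n} → r ⊆ p → r ⊆ q → r ⊆ p ∩ q
∩-glb r⊆p r⊆q x∈ = x∈p∩q⁺ (r⊆p x∈ , r⊆q x∈)

⁅⁆-⊆ : {x : Fin n} {p : Subset n} → x ∈ p → ⁅ x ⁆ ⊆ p
⁅⁆-⊆ {x = x} {p} x∈p y∈ = subst (_∈ p) (sym (x∈⁅y⁆⇒x≡y x y∈)) x∈p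

Disjoint : Subset n → Subset n → Set
Disjoint p q = ∀ {x} → x ∈ p → x ∉ q

disjoint⇒∣p∣+∣q∣≤∣p∪q∣ : (p q : Subset n) → Disjoint p q → ∣ p ∣ + ∣ q ∣ ≤ ∣ p ∪ q ∣
disjoint⇒∣p∣+∣q∣≤∣p∪q∣ {n} p q disj = begin
  ∣ p ∣ + ∣ q ∣          ≡⟨ ∣p∪q∣+∣p∩q∣≡∣p∣+∣q∣ p q ⟨
  ∣ p ∪ q ∣ + ∣ p ∩ q ∣  ≤⟨ +-monoʳ-≤ _ (p⊆q⇒∣p∣≤∣q∣ p∩q⊆⊥) ⟩
  ∣ p ∪ q ∣ + ∣ ⊥ {n} ∣  ≡⟨ trans (cong (∣ p ∪ q ∣ +_) (∣⊥∣≡0 n)) (+-identityʳ _) ⟩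
  ∣ p ∪ q ∣              ∎
  where
  open ≤-Reasoning
  p∩q⊆⊥ : p ∩ q ⊆ ⊥
  p∩q⊆⊥ x∈ = let x∈p , x∈q = x∈p∩q⁻ p q x∈ in contradiction x∈q (disj x∈p)

infixl 7 _∖_
_∖_ : Subset n → Fin n → Subset n
p ∖ x = p ∩ ∁ ⁅ x ⁆

p∖x⊆p : (p : Subset n) (x : Fin n) → p ∖ x ⊆ p
p∖x⊆p p x = p∩q⊆p p (∁ ⁅ x ⁆)

x∉p∖x : (p : Subset n) (x : Fin n) → x ∉ p ∖ x
x∉p∖x p x x∈ = x∈∁p⇒x∉p (proj₂ (x∈p∩q⁻ p (∁ ⁅ x ⁆) x∈)) (x∈⁅x⁆ x)

∈-∖ : {p : Subset n} {x y : Fin n} → y ∈ p → y ≢ x → y ∈ p ∖ x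
∈-∖ y∈p y≢x = x∈p∩q⁺ (y∈p , x∉p⇒x∈∁p (x≢y⇒x∉⁅y⁆ y≢x))

⊆-∖ : {p q : Subset n} {x : Fin n} → q ⊆ p → x ∉ q → q ⊆ p ∖ x
⊆-∖ q⊆p x∉q y∈q = ∈-∖ (q⊆p y∈q) λ { refl → x∉q y∈q }

p⊆p∖x∪x : (p : Subset n) (x : Fin n) → p ⊆ p ∖ x ∪ ⁅ x ⁆
p⊆p∖x∪x p x {y} y∈p with y ≟ᶠ x
... | yes refl = q⊆p∪q _ _ (x∈⁅x⁆ x)
... | no  y≢x  = p⊆p∪q _ (∈-∖ y∈p y≢x)

∣p∖x∣<∣p∣ : {p : Subset n} {x : Fin n} → x ∈ p → ∣ p ∖ x ∣ < ∣ p ∣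
∣p∖x∣<∣p∣ {p = p} {x} x∈p = p⊂q⇒∣p∣<∣q∣ (p∖x⊆p p x , x , x∈p , x∉p∖x p x)

∣p∪x∣≤1+∣p∣ : (p : Subset n) (x : Fin n) → ∣ p ∪ ⁅ x ⁆ ∣ ≤ suc ∣ p ∣
∣p∪x∣≤1+∣p∣ p x = begin
  ∣ p ∪ ⁅ x ⁆ ∣      ≤⟨ ∣p∪q∣≤∣p∣+∣q∣ p ⁅ x ⁆ ⟩
  ∣ p ∣ + ∣ ⁅ x ⁆ ∣  ≡⟨ cong (∣ p ∣ +_) (∣⁅x⁆∣≡1 x) ⟩
  ∣ p ∣ + 1          ≡⟨ +-comm ∣ p ∣ 1 ⟩
  suc ∣ p ∣          ∎
  where open ≤-Reasoning

∣p∣≤1+∣p∖x∣ : (p : Subset n) (x : Fin n) → ∣ p ∣ ≤ suc ∣ p ∖ x ∣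
∣p∣≤1+∣p∖x∣ p x = ≤-trans (p⊆q⇒∣p∣≤∣q∣ (p⊆p∖x∪x p x)) (∣p∪x∣≤1+∣p∣ (p ∖ x) x)

x∉p⇒∣p∣<∣p∪x∣ : {p : Subset n} {x : Fin n} → x ∉ p → ∣ p ∣ < ∣ p ∪ ⁅ x ⁆ ∣
x∉p⇒∣p∣<∣p∪x∣ {p = p} {x} x∉p =
  p⊂q⇒∣p∣<∣q∣ (p⊆p∪q ⁅ x ⁆ , x , q⊆p∪q p ⁅ x ⁆ (x∈⁅x⁆ x) , x∉p)

x∈p⇒1≤∣p∣ : {p : Subset n} {x : Fin n} → x ∈ p → 1 ≤ ∣ p ∣
x∈p⇒1≤∣p∣ x∈p = ≤-trans (s≤s z≤n) (∣p∖x∣<∣p∣ x∈p)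

module _ {P : Fin n → Set} (P? : Decidable P) where

  comprehension : Subset n
  comprehension = tabulate λ x → ⌊ P? x ⌋

  ∈-comprehension⁺ : ∀ {x} → P x → x ∈ comprehension
  ∈-comprehension⁺ {x} px = lookup⇒[]= x _ (trans (lookup∘tabulate _ x) holds)
    where
    holds : ⌊ P? x ⌋ ≡ true
    holds with P? x
    ... | yes _  = refl
    ... | no ¬px = contradiction px ¬px

  ∈-comprehension⁻ : ∀ {x} → x ∈ comprehension → P x
  ∈-comprehension⁻ {x} x∈ with P? x | trans (sym (lookup∘tabulate (λ y → ⌊ P? y ⌋) x)) ([]=⇒lookup x∈)
  ... | yes px | _ = px

-- Matroids

module _ (M : Matroid m) where
  open Matroid M

  independent? : ∀ X → Dec (Independent M X)
  independent? X = rank X ≟ ∣ X ∣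

  submodular : ∀ {A B P Q} → P ⊆ A ∪ B → Q ⊆ A ∩ B → rank P + rank Q ≤ rank A + rank B
  submodular P⊆ Q⊆ = ≤-trans (+-mono-≤ (rank-mono P⊆) (rank-mono Q⊆)) (rank-sub _ _)

  -- Diminishing returns: submodularity for `A ∪ ⁅ g ⁆` and `B` shows that `g` raises the rank of
  -- `A` at least as much as that of the larger set `B`.
  rank-strict-⊆ : ∀ {A B g} → A ⊆ B → ¬ InClosure M g B → rank A < rank (A ∪ ⁅ g ⁆)
  rank-strict-⊆ {A} {B} {g} A⊆B g∉clB = +-cancelʳ-≤ (rank B) _ _ (begin
    suc (rank A) + rank B       ≡⟨ trans (sym (+-suc _ _)) (+-comm (rank A) _) ⟩
    suc (rank B) + rank A       ≤⟨ +-monoˡ-≤ (rank A) (≤∧≢⇒< (rank-mono (p⊆p∪q ⁅ g ⁆)) (g∉clB ∘ sym)) ⟩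
    rank (B ∪ ⁅ g ⁆) + rank A   ≤⟨ submodular
        (∪-lub (q⊆p∪q _ _) (p⊆p∪q _ ∘ q⊆p∪q _ _)) (∩-glb (p⊆p∪q _) A⊆B) ⟩
    rank (A ∪ ⁅ g ⁆) + rank B   ∎)
    where open ≤-Reasoning

  -- The elements of `X` outside `Y` add at most their number to the rank, so a rank deficit in `Y`
  -- would persist in `X`.
  independent-⊆ : ∀ {X Y} → Y ⊆ X → Independent M X → Independent M Y
  independent-⊆ {X} {Y} Y⊆X ind = ≤-antisym (rank-≤ Y) (+-cancelʳ-≤ ∣ X ∩ ∁ Y ∣ _ _ (begin
    ∣ Y ∣ + ∣ X ∩ ∁ Y ∣        ≤⟨ disjoint⇒∣p∣+∣q∣≤∣p∪q∣ Y _
        (λ y∈Y y∈ → x∈∁p⇒x∉p (p∩q⊆q X _ y∈) y∈Y) ⟩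
    ∣ Y ∪ X ∩ ∁ Y ∣            ≤⟨ p⊆q⇒∣p∣≤∣q∣ (∪-lub Y⊆X (p∩q⊆p X _)) ⟩
    ∣ X ∣                      ≡⟨ ind ⟨
    rank X                     ≤⟨ m≤m+n _ _ ⟩
    rank X + rank ⊥            ≤⟨ submodular X⊆ ⊥⊆ ⟩
    rank Y + rank (X ∩ ∁ Y)    ≤⟨ +-monoʳ-≤ _ (rank-≤ _) ⟩
    rank Y + ∣ X ∩ ∁ Y ∣       ∎))
    where
    open ≤-Reasoning
    X⊆ : X ⊆ Y ∪ X ∩ ∁ Y
    X⊆ {x} x∈X with x ∈? Y
    ... | yes x∈Y = p⊆p∪q _ x∈Y
    ... | no  x∉Y = q⊆p∪q _ _ (x∈p∩q⁺ (x∈X , x∉p⇒x∈∁p x∉Y))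

  circuit-proper : ∀ {C Y f} → Circuit M C → Y ⊆ C → f ∈ C → f ∉ Y → Independent M Y
  circuit-proper circ Y⊆C f∈C f∉Y = proj₂ circ _ (Y⊆C , _ , f∈C , f∉Y)

  rank-circuit< : ∀ {C} → Circuit M C → rank C < ∣ C ∣
  rank-circuit< circ = ≤∧≢⇒< (rank-≤ _) (proj₁ circ)

  circuit-nonempty : ∀ {C} → Circuit M C → ∃ λ f → f ∈ C
  circuit-nonempty {C} circ with nonempty? C
  ... | yes ne = ne
  ... | no  em = contradiction
    (n≤0⇒n≡0 (≤-trans (rank-≤ C) (≤-reflexive (trans (cong ∣_∣ (Empty-unique em)) (∣⊥∣≡0 m)))))
    λ r≡0 → <⇒≢ (rank-circuit< circ) (trans r≡0 (sym (trans (cong ∣_∣ (Empty-unique em)) (∣⊥∣≡0 m))))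

  -- Elements are deleted as long as the set stays dependent, with `k` bounding its size. Once every
  -- single deletion gives an independent set, all proper subsets are independent by
  -- `independent-⊆`.
  dependent⇒circuit : ∀ X → ¬ Independent M X → ∃ λ C → C ⊆ X × Circuit M C
  dependent⇒circuit X = go ∣ X ∣ X ≤-refl
    where
    go : ∀ k X → ∣ X ∣ ≤ k → ¬ Independent M X → ∃ λ C → C ⊆ X × Circuit M C
    go k X ∣X∣≤k dep with any? (λ f → f ∈? X ×-dec ¬? (independent? (X ∖ f)))
    go zero    X ∣X∣≤k dep | yes (f , f∈X , dep′) = contradiction (≤-trans (∣p∖x∣<∣p∣ f∈X) ∣X∣≤k) λ ()
    go (suc k) X ∣X∣≤k dep | yes (f , f∈X , dep′) =
      let C , C⊆ , circ = go k (X ∖ f) (≤-pred (≤-trans (∣p∖x∣<∣p∣ f∈X) ∣X∣≤k)) dep′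
      in C , p∖x⊆p X f ∘ C⊆ , circ
    ... | no none = X , id , dep , λ Y (Y⊆X , f , f∈X , f∉Y) →
      independent-⊆ (⊆-∖ Y⊆X f∉Y) (decidable-stable (independent? _) λ dep′ → none (f , f∈X , dep′))

  -- Deleting `f` costs the circuit no rank, since `C` without `f` is independent and only one
  -- element smaller. Submodularity of `X` without `f` against `C` carries this over to `X`.
  rank-circuit-∖ : ∀ {C X f} → Circuit M C → C ⊆ X → f ∈ C → rank X ≤ rank (X ∖ f)
  rank-circuit-∖ {C} {X} {f} circ C⊆X f∈C = +-cancelʳ-≤ (rank (C ∖ f)) _ _ (begin
    rank X + rank (C ∖ f)        ≤⟨ submodular X⊆
        (∩-glb (⊆-∖ (C⊆X ∘ p∖x⊆p C f) (x∉p∖x C f)) (p∖x⊆p C f)) ⟩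
    rank (X ∖ f) + rank C        ≤⟨ +-monoʳ-≤ _ C≤ ⟩
    rank (X ∖ f) + rank (C ∖ f)  ∎)
    where
    open ≤-Reasoning
    X⊆ : X ⊆ X ∖ f ∪ C
    X⊆ = ∪-lub (p⊆p∪q _) (⁅⁆-⊆ (q⊆p∪q _ _ f∈C)) ∘ p⊆p∖x∪x X f
    C≤ : rank C ≤ rank (C ∖ f)
    C≤ = ≤-pred (≤-trans (rank-circuit< circ) (≤-trans (∣p∣≤1+∣p∖x∣ C f)
      (s≤s (≤-reflexive (sym (circuit-proper circ (p∖x⊆p C f) f∈C (x∉p∖x C f)))))))

  basis : ∀ X → ∃ λ B → B ⊆ X × Independent M B × rank X ≤ ∣ B ∣
  basis X = go ∣ X ∣ X ≤-refl
    where
    go : ∀ k X → ∣ X ∣ ≤ k → ∃ λ B → B ⊆ X × Independent M B × rank X ≤ ∣ B ∣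
    go k X ∣X∣≤k with independent? X
    ... | yes ind = X , id , ind , rank-≤ X
    ... | no dep with dependent⇒circuit X dep
    ... | C , C⊆X , circ with circuit-nonempty circ
    go zero    X ∣X∣≤k | no dep | C , C⊆X , circ | f , f∈C =
      contradiction (≤-trans (∣p∖x∣<∣p∣ (C⊆X f∈C)) ∣X∣≤k) λ ()
    go (suc k) X ∣X∣≤k | no dep | C , C⊆X , circ | f , f∈C =
      let B , B⊆ , ind , r≤ = go k (X ∖ f) (≤-pred (≤-trans (∣p∖x∣<∣p∣ (C⊆X f∈C)) ∣X∣≤k))
      in B , p∖x⊆p X f ∘ B⊆ , ind , ≤-trans (rank-circuit-∖ circ C⊆X f∈C) r≤

  -- A circuit inside the union of a basis of `T` and a basis of `T′` would lie within one of the
  -- two bases, so the union is independent.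
  rank-direct-sum : ∀ {T T′} → Disjoint T T′ → (∀ C → Circuit M C → C ⊆ T ⊎ C ⊆ T′) →
    rank T + rank T′ ≤ rank ⊤
  rank-direct-sum {T} {T′} disj split with basis T | basis T′
  ... | B , B⊆T , ind , T≤B | B′ , B′⊆T′ , ind′ , T′≤B′ = begin
    rank T + rank T′  ≤⟨ +-mono-≤ T≤B T′≤B′ ⟩
    ∣ B ∣ + ∣ B′ ∣    ≤⟨ disjoint⇒∣p∣+∣q∣≤∣p∪q∣ B B′ (λ x∈B x∈B′ → disj (B⊆T x∈B) (B′⊆T′ x∈B′)) ⟩
    ∣ B ∪ B′ ∣        ≡⟨ decidable-stable (independent? _) no-circuit ⟨
    rank (B ∪ B′)     ≤⟨ rank-mono ⊆⊤ ⟩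
    rank ⊤            ∎
    where
    open ≤-Reasoning
    no-circuit : ¬ ¬ Independent M (B ∪ B′)
    no-circuit dep with dependent⇒circuit _ dep
    ... | C , C⊆ , circ with split C circ
    ... | inj₁ C⊆T = proj₁ circ (independent-⊆
      (λ x∈C → [ id , (λ x∈B′ → contradiction (B′⊆T′ x∈B′) (disj (C⊆T x∈C))) ] (x∈p∪q⁻ B B′ (C⊆ x∈C))) ind)
    ... | inj₂ C⊆T′ = proj₁ circ (independent-⊆
      (λ x∈C → [ (λ x∈B → contradiction (C⊆T′ x∈C) (disj (B⊆T x∈B))) , id ] (x∈p∪q⁻ B B′ (C⊆ x∈C))) ind′)

-- Connectivity

module _ (G : Graph n m) where

  conn-trans : ∀ {X u v w} → Conn G X u v → Conn G X v w → Conn G X u w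
  conn-trans p here          = p
  conn-trans p (fwd g g∈X q) = fwd g g∈X (conn-trans p q)
  conn-trans p (bwd g g∈X q) = bwd g g∈X (conn-trans p q)

  conn-sym : ∀ {X u v} → Conn G X u v → Conn G X v u
  conn-sym here          = here
  conn-sym (fwd g g∈X p) = conn-trans (bwd g g∈X here) (conn-sym p)
  conn-sym (bwd g g∈X p) = conn-trans (fwd g g∈X here) (conn-sym p)

  -- Only edges reachable from `u` have to lie in `Y`. This is what allows a walk to be confined to
  -- one component of `X`.
  conn-restrict : ∀ {X Y u v} → (∀ {g} → g ∈ X → Conn G X u (end₁ G g) → g ∈ Y) →
    Conn G X u v → Conn G Y u v
  conn-restrict sub here          = here
  conn-restrict sub (fwd g g∈X p) = fwd g (sub g∈X p) (conn-restrict sub p)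
  conn-restrict sub (bwd g g∈X p) = bwd g (sub g∈X (bwd g g∈X p)) (conn-restrict sub p)

  conn-mono : ∀ {X Y u v} → X ⊆ Y → Conn G X u v → Conn G Y u v
  conn-mono X⊆Y = conn-restrict λ g∈X _ → X⊆Y g∈X

  conn-ends : ∀ {X g w} → g ∈ X → Inc G g w → Conn G X (end₁ G g) w
  conn-ends g∈X (inj₁ refl) = here
  conn-ends g∈X (inj₂ refl) = fwd _ g∈X here

  vertexOf-mono : ∀ {X Y w} → X ⊆ Y → VertexOf G X w → VertexOf G Y w
  vertexOf-mono X⊆Y (g , g∈X , inc) = g , X⊆Y g∈X , inc

  conn-vertexOf : ∀ {X u w} → Conn G X u w → VertexOf G X u → VertexOf G X w
  conn-vertexOf here          u∈X = u∈X
  conn-vertexOf (fwd g g∈X _) _   = g , g∈X , inj₂ refl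
  conn-vertexOf (bwd g g∈X _) _   = g , g∈X , inj₁ refl

  inc? : ∀ g w → Dec (Inc G g w)
  inc? g w = (end₁ G g ≟ᶠ w) ⊎-dec (end₂ G g ≟ᶠ w)

  vertexOf? : ∀ X w → Dec (VertexOf G X w)
  vertexOf? X w = any? λ g → g ∈? X ×-dec inc? g w

  ∈-EdgesAvoiding⁺ : ∀ {g w} → ¬ Inc G g w → g ∈ EdgesAvoiding G w
  ∈-EdgesAvoiding⁺ {g} {w} ¬inc = lookup⇒[]= g _ (trans (lookup∘tabulate _ g) avoids)
    where
    avoids : not ⌊ end₁ G g ≟ᶠ w ⌋ ∧ not ⌊ end₂ G g ≟ᶠ w ⌋ ≡ true
    avoids with end₁ G g ≟ᶠ w | end₂ G g ≟ᶠ w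
    ... | yes p | _     = contradiction (inj₁ p) ¬inc
    ... | no _  | yes q = contradiction (inj₂ q) ¬inc
    ... | no _  | no _  = refl

  ∈-EdgesAvoiding⁻ : ∀ {g w} → g ∈ EdgesAvoiding G w → ¬ Inc G g w
  ∈-EdgesAvoiding⁻ {g} {w} g∈ inc
    with end₁ G g ≟ᶠ w | end₂ G g ≟ᶠ w
       | trans (sym (lookup∘tabulate (λ h → not ⌊ end₁ G h ≟ᶠ w ⌋ ∧ not ⌊ end₂ G h ≟ᶠ w ⌋) g)) ([]=⇒lookup g∈)
  ... | no p | no q | _ = [ p , q ] inc

  ∈-LoopsAt⁻ : ∀ {g w} → g ∈ LoopsAt G w → IsLoopAt G g w
  ∈-LoopsAt⁻ {g} {w} g∈
    with end₁ G g ≟ᶠ w | end₂ G g ≟ᶠ w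
       | trans (sym (lookup∘tabulate (λ h → ⌊ end₁ G h ≟ᶠ w ⌋ ∧ ⌊ end₂ G h ≟ᶠ w ⌋) g)) ([]=⇒lookup g∈)
  ... | yes p | yes q | _ = p , q

  -- Growing connected subgraphs by pendant edges

  Spans : Subset m → Subset n → Set
  Spans Y S = ∀ {g} → g ∈ Y → end₁ G g ∈ S × end₂ G g ∈ S

  spans-avoiding : ∀ {Y S w} → Spans Y S → w ∉ S → Y ⊆ EdgesAvoiding G w
  spans-avoiding sp w∉S g∈Y = ∈-EdgesAvoiding⁺
    [ (λ { refl → w∉S (proj₁ (sp g∈Y)) }) , (λ { refl → w∉S (proj₂ (sp g∈Y)) }) ]

  -- Isolates what cardinality, rank, and the rank of the union with a fixed set have in common, so
  -- that one growth argument serves all three.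
  PendantIncreasing : Subset m → (Subset m → ℕ) → Set
  PendantIncreasing X φ = ∀ {Y g w} → g ∈ X → Inc G g w → ¬ IsLoopAt G g w →
    Y ⊆ EdgesAvoiding G w → φ Y < φ (Y ∪ ⁅ g ⁆)

  module _ {X : Subset m} {u : Fin n} where

    component-conn : ∀ {S T w} → IsComponentAt G X u S T → w ∈ S → Conn G X u w
    component-conn comp = to (proj₁ comp _)

    component-⊆ : ∀ {S T} → IsComponentAt G X u S T → T ⊆ X
    component-⊆ comp g∈T = proj₁ (to (proj₂ comp _) g∈T)

    component-spans : ∀ {S T} → IsComponentAt G X u S T → Spans T S
    component-spans comp {g} g∈T =
      let g∈X , p = to (proj₂ comp g) g∈T
      in from (proj₁ comp _) p , from (proj₁ comp _) (fwd g g∈X p)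

    -- Each new vertex is reached along a pendant edge, so φ grows at least as fast as S.
    grow : (φ : Subset m → ℕ) → (∀ {Y Z} → Y ⊆ Z → φ Y ≤ φ Z) → PendantIncreasing X φ →
      ∀ S Y → u ∈ S → (∀ {w} → w ∈ S → Conn G X u w) → Y ⊆ X → Spans Y S →
      ∃₂ λ S′ T → IsComponentAt G X u S′ T × ∣ S′ ∣ + φ Y ≤ ∣ S ∣ + φ T
    -- The counter bounds the number of vertices still outside the current set: `n ≤ k + ∣ S ∣` is
    -- kept throughout, so at `k = 0` no new vertex can be found.
    grow φ mono incr S₀ Y₀ = go n S₀ Y₀ (m≤m+n n ∣ S₀ ∣)
      where
      Exits : Subset n → Fin m → Set
      Exits S g = g ∈ X × ((end₁ G g ∈ S × end₂ G g ∉ S) ⊎ (end₂ G g ∈ S × end₁ G g ∉ S))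

      exits? : ∀ S g → Dec (Exits S g)
      exits? S g = g ∈? X ×-dec
        ((end₁ G g ∈? S ×-dec ¬? (end₂ G g ∈? S)) ⊎-dec (end₂ G g ∈? S ×-dec ¬? (end₁ G g ∈? S)))

      Goal : Subset n → Subset m → Set
      Goal S Y = ∃₂ λ S′ T → IsComponentAt G X u S′ T × ∣ S′ ∣ + φ Y ≤ ∣ S ∣ + φ T

      -- When no edge of `X` leaves `S`, walks from `u` stay in `S`. Passing from `Y` to all edges
      -- of `X` within `S` can only increase `φ`.
      closed : ∀ S Y → u ∈ S → (∀ {w} → w ∈ S → Conn G X u w) → Y ⊆ X → Spans Y S →
        ¬ ∃ (Exits S) → Goal S Y
      closed S Y u∈S conn Y⊆X sp none = S , T ,
        ((λ w → mk⇔ conn reached) ,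
         (λ g → mk⇔ (λ g∈T → let g∈X , p = ∈-comprehension⁻ T? g∈T in g∈X , conn p)
                    (λ (g∈X , p) → ∈-comprehension⁺ T? (g∈X , reached p)))) ,
        +-monoʳ-≤ ∣ S ∣ (mono λ g∈Y → ∈-comprehension⁺ T? (Y⊆X g∈Y , proj₁ (sp g∈Y)))
        where
        T? : Decidable (λ g → g ∈ X × end₁ G g ∈ S)
        T? g = g ∈? X ×-dec end₁ G g ∈? S
        T = comprehension T?
        reached : ∀ {w} → Conn G X u w → w ∈ S
        reached here = u∈S
        reached (fwd g g∈X p) = decidable-stable (_ ∈? S) λ ∉S → none (g , g∈X , inj₁ (reached p , ∉S))
        reached (bwd g g∈X p) = decidable-stable (_ ∈? S) λ ∉S → none (g , g∈X , inj₂ (reached p , ∉S))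

      go : ∀ k S Y → n ≤ k + ∣ S ∣ → u ∈ S → (∀ {w} → w ∈ S → Conn G X u w) → Y ⊆ X → Spans Y S → Goal S Y

      step : ∀ k S Y → n ≤ k + ∣ S ∣ → u ∈ S → (∀ {w} → w ∈ S → Conn G X u w) → Y ⊆ X → Spans Y S →
        ∀ {g w} → g ∈ X → Inc G g w → w ∉ S → ¬ IsLoopAt G g w → Conn G X u w →
        (∀ {x} → Inc G g x → x ∈ S ⊎ x ≡ w) → Goal S Y
      step zero S Y n≤ _ _ _ _ {w = w} _ _ w∉S _ _ _ =
        contradiction (≤-trans (x∉p⇒∣p∣<∣p∪x∣ w∉S) (≤-trans (∣p∣≤n (S ∪ ⁅ w ⁆)) n≤)) (n≮n _)
      step (suc k) S Y n≤ u∈S conn Y⊆X sp {g} {w} g∈X inc w∉S ¬loop conn-w ends =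
        let S′ , T , comp , ineq = go k (S ∪ ⁅ w ⁆) (Y ∪ ⁅ g ⁆)
              (≤-trans n≤ (≤-trans (≤-reflexive (sym (+-suc k _))) (+-monoʳ-≤ k (x∉p⇒∣p∣<∣p∪x∣ w∉S))))
              (p⊆p∪q _ u∈S)
              (λ x∈ → [ conn , (λ x∈w → subst (Conn G X u) (sym (x∈⁅y⁆⇒x≡y w x∈w)) conn-w) ] (x∈p∪q⁻ S _ x∈))
              (∪-lub Y⊆X (⁅⁆-⊆ g∈X))
              (λ h∈ → [ (λ h∈Y → p⊆p∪q _ (proj₁ (sp h∈Y)) , p⊆p∪q _ (proj₂ (sp h∈Y))) ,
                        (λ h∈g → subst (λ h → end₁ G h ∈ S ∪ ⁅ w ⁆ × end₂ G h ∈ S ∪ ⁅ w ⁆)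
                                       (sym (x∈⁅y⁆⇒x≡y g h∈g))
                                       (end∈ (ends (inj₁ refl)) , end∈ (ends (inj₂ refl)))) ]
                      (x∈p∪q⁻ Y _ h∈))
        in S′ , T , comp , ≤-pred (begin
          suc (∣ S′ ∣ + φ Y)           ≡⟨ +-suc _ _ ⟨
          ∣ S′ ∣ + suc (φ Y)           ≤⟨ +-monoʳ-≤ _ (incr g∈X inc ¬loop (spans-avoiding sp w∉S)) ⟩
          ∣ S′ ∣ + φ (Y ∪ ⁅ g ⁆)       ≤⟨ ineq ⟩
          ∣ S ∪ ⁅ w ⁆ ∣ + φ T          ≤⟨ +-monoˡ-≤ _ (∣p∪x∣≤1+∣p∣ S w) ⟩
          suc (∣ S ∣ + φ T)            ∎)
        where
        open ≤-Reasoning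
        end∈ : ∀ {x} → x ∈ S ⊎ x ≡ w → x ∈ S ∪ ⁅ w ⁆
        end∈ (inj₁ x∈S)  = p⊆p∪q _ x∈S
        end∈ (inj₂ refl) = q⊆p∪q _ _ (x∈⁅x⁆ _)

      go k S Y n≤ u∈S conn Y⊆X sp with any? (exits? S)
      ... | no none = closed S Y u∈S conn Y⊆X sp none
      ... | yes (g , g∈X , inj₁ (a∈S , b∉S)) = step k S Y n≤ u∈S conn Y⊆X sp g∈X (inj₂ refl) b∉S
        (λ (a≡b , _) → b∉S (subst (_∈ S) a≡b a∈S)) (fwd g g∈X (conn a∈S))
        [ (λ { refl → inj₁ a∈S }) , inj₂ ∘ sym ]
      ... | yes (g , g∈X , inj₂ (b∈S , a∉S)) = step k S Y n≤ u∈S conn Y⊆X sp g∈X (inj₁ refl) a∉S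
        (λ (_ , b≡a) → a∉S (subst (_∈ S) b≡a b∈S)) (bwd g g∈X (conn b∈S))
        [ inj₂ ∘ sym , (λ { refl → inj₁ b∈S }) ]

  card-pendant : ∀ {X} → PendantIncreasing X ∣_∣
  card-pendant _ inc _ Y⊆ = x∉p⇒∣p∣<∣p∪x∣ λ g∈Y → ∈-EdgesAvoiding⁻ (Y⊆ g∈Y) inc

  component : ∀ X u → ∃₂ λ S T → IsComponentAt G X u S T
  component X u =
    let S , T , comp , _ = grow ∣_∣ p⊆q⇒∣p∣≤∣q∣ card-pendant ⁅ u ⁆ ⊥ (x∈⁅x⁆ u)
          (λ w∈ → subst (Conn G X u) (sym (x∈⁅y⁆⇒x≡y u w∈)) here)
          (λ g∈ → contradiction g∈ ∉⊥) (λ g∈ → contradiction g∈ ∉⊥)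
    in S , T , comp

  -- Walks have unbounded length, so decidability comes from the vertex set of the constructed
  -- component.
  conn? : ∀ X u w → Dec (Conn G X u w)
  conn? X u w with component X u
  ... | S , T , comp with w ∈? S
  ... | yes w∈S = yes (component-conn comp w∈S)
  ... | no  w∉S = no (w∉S ∘ from (proj₁ comp w))

  -- Bounds on components pass down to subsets. A component of `Y` grows into one of `X`, each new
  -- vertex raising `φ` by at least one, so any excess of `φ T` over `∣ S ∣` would survive in `X`.
  -- With `φ` the rank it extends condition (2) of a framework; with cardinality it transfers
  -- sparsity.
  component-grow : ∀ {X Y u S T} (φ : Subset m → ℕ) → (∀ {Y Z} → Y ⊆ Z → φ Y ≤ φ Z) →
    PendantIncreasing X φ → (∀ {S T} → IsComponentAt G X u S T → φ T ≤ ∣ S ∣) →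
    Y ⊆ X → IsComponentAt G Y u S T → φ T ≤ ∣ S ∣
  component-grow {u = u} {S} {T} φ mono incr bound Y⊆X comp =
    let S′ , T′ , comp′ , ineq = grow φ mono incr S T (from (proj₁ comp _) here)
          (conn-mono Y⊆X ∘ component-conn comp) (Y⊆X ∘ component-⊆ comp) (component-spans comp)
    in +-cancelʳ-≤ ∣ S′ ∣ _ _ (begin
      φ T + ∣ S′ ∣      ≡⟨ +-comm (φ T) _ ⟩
      ∣ S′ ∣ + φ T      ≤⟨ ineq ⟩
      ∣ S ∣ + φ T′      ≤⟨ +-monoʳ-≤ ∣ S ∣ (bound comp′) ⟩
      ∣ S ∣ + ∣ S′ ∣    ∎)
    where open ≤-Reasoning

-- Sums and degrees

sum-tight : ∀ {n} {f g : Fin n → ℕ} → (∀ i → f i ≤ g i) → sum g ≤ sum f → ∀ i → g i ≡ f i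
sum-mono  : ∀ {n} {f g : Fin n → ℕ} → (∀ i → f i ≤ g i) → sum f ≤ sum g

sum-mono {zero}  f≤g = z≤n
sum-mono {suc n} f≤g = +-mono-≤ (f≤g zero) (sum-mono (f≤g ∘ suc))

sum-tight {suc n} {f} {g} f≤g Σg≤Σf zero = ≤-antisym (+-cancelʳ-≤ (sum (f ∘ suc)) _ _
  (≤-trans (+-monoʳ-≤ (g zero) (sum-mono (f≤g ∘ suc))) Σg≤Σf)) (f≤g zero)
sum-tight {suc n} {f} {g} f≤g Σg≤Σf (suc i) = sum-tight (f≤g ∘ suc)
  (+-cancelˡ-≤ (f zero) _ _ (≤-trans (+-monoˡ-≤ _ (f≤g zero)) Σg≤Σf)) i

term≤sum : ∀ {n} (f : Fin n → ℕ) i → f i ≤ sum f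
term≤sum f zero    = m≤m+n _ _
term≤sum f (suc i) = ≤-trans (term≤sum (f ∘ suc) i) (m≤n+m _ _)

two-terms≤sum : ∀ {n} (f : Fin n → ℕ) {i j} → i ≢ j → f i + f j ≤ sum f
two-terms≤sum f {zero}  {zero}  i≢j = contradiction refl i≢j
two-terms≤sum f {zero}  {suc j} i≢j = +-monoʳ-≤ (f zero) (term≤sum (f ∘ suc) j)
two-terms≤sum f {suc i} {zero}  i≢j =
  ≤-trans (≤-reflexive (+-comm (f (suc i)) _)) (+-monoʳ-≤ (f zero) (term≤sum (f ∘ suc) i))
two-terms≤sum f {suc i} {suc j} i≢j = ≤-trans (two-terms≤sum (f ∘ suc) (i≢j ∘ cong suc)) (m≤n+m _ _)

indicator : Bool → ℕ
indicator b = if b then 1 else 0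

sum-indicator : (p : Subset n) → sum (λ x → indicator (lookup p x)) ≡ ∣ p ∣
sum-indicator []          = refl
sum-indicator (true  ∷ p) = cong suc (sum-indicator p)
sum-indicator (false ∷ p) = sum-indicator p

sum-indicator-≟ : (a : Fin n) → sum (λ v → indicator ⌊ a ≟ᶠ v ⌋) ≡ 1
sum-indicator-≟ a = trans (sum-cong-≗ same) (trans (sum-indicator ⁅ a ⁆) (∣⁅x⁆∣≡1 a))
  where
  same : ∀ v → indicator ⌊ a ≟ᶠ v ⌋ ≡ indicator (lookup ⁅ a ⁆ v)
  same v with a ≟ᶠ v | lookup ⁅ a ⁆ v in eq
  ... | yes _    | true  = refl
  ... | no _     | false = refl
  ... | yes refl | false = contradiction (trans (sym eq) ([]=⇒lookup (x∈⁅x⁆ a))) λ ()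
  ... | no a≢v   | true  = contradiction (sym (x∈⁅y⁆⇒x≡y a (lookup⇒[]= v _ eq))) a≢v

module _ (G : Graph n m) where

  endsAt : Fin m → Fin n → ℕ
  endsAt g v = indicator ⌊ end₁ G g ≟ᶠ v ⌋ + indicator ⌊ end₂ G g ≟ᶠ v ⌋

  contribution : Subset m → Fin n → Fin m → ℕ
  contribution X v g = if lookup X g then endsAt g v else 0

  degree≡sum : ∀ X v → degree G X v ≡ sum (contribution X v)
  degree≡sum X v = sum-cong-≗ same
    where
    -- The summand of degree is local to its definition, so it is recovered by unification.
    summand : ∀ {f : Fin m → ℕ} → degree G X v ≡ sum f → Fin m → ℕ
    summand {f} _ = f
    same : ∀ g → summand refl g ≡ contribution X v g
    same g with lookup X g
    ... | false = refl
    ... | true with end₁ G g ≟ᶠ v | end₂ G g ≟ᶠ v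
    ... | yes _ | yes _ = refl
    ... | yes _ | no _  = refl
    ... | no _  | yes _ = refl
    ... | no _  | no _  = refl

  -- Double counting of edge ends: after the sums are exchanged every edge of `X` gives exactly two,
  -- a loop giving both at the same vertex.
  handshake : ∀ X → sum (degree G X) ≡ ∣ X ∣ + ∣ X ∣
  handshake X = begin
    sum (degree G X)                                     ≡⟨ sum-cong-≗ (degree≡sum X) ⟩
    sum (λ v → sum (contribution X v))                   ≡⟨ ∑-comm (contribution X) ⟩
    sum (λ g → sum (λ v → contribution X v g))           ≡⟨ sum-cong-≗ two-ends ⟩
    sum (λ g → indicator (lookup X g) + indicator (lookup X g))
      ≡⟨ ∑-distrib-+ (indicator ∘ lookup X) (indicator ∘ lookup X) ⟩
    sum (indicator ∘ lookup X) + sum (indicator ∘ lookup X)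
      ≡⟨ cong₂ _+_ (sum-indicator X) (sum-indicator X) ⟩
    ∣ X ∣ + ∣ X ∣                                        ∎
    where
    open ≡-Reasoning
    sum-zero : ∀ n → sum {n} (λ _ → 0) ≡ 0
    sum-zero zero    = refl
    sum-zero (suc n) = sum-zero n
    two-ends : ∀ g → sum (λ v → contribution X v g) ≡ indicator (lookup X g) + indicator (lookup X g)
    two-ends g with lookup X g
    ... | false = sum-zero n
    ... | true  = trans (∑-distrib-+ (λ v → indicator ⌊ end₁ G g ≟ᶠ v ⌋) (λ v → indicator ⌊ end₂ G g ≟ᶠ v ⌋))
      (cong₂ _+_ (sum-indicator-≟ (end₁ G g)) (sum-indicator-≟ (end₂ G g)))

  module _ {X : Subset m} {v : Fin n} where

    contribution-≥1 : ∀ {g} → g ∈ X → Inc G g v → 1 ≤ contribution X v g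
    contribution-≥1 {g} g∈X inc rewrite []=⇒lookup g∈X with end₁ G g ≟ᶠ v | end₂ G g ≟ᶠ v
    ... | yes _ | _     = s≤s z≤n
    ... | no _  | yes _ = s≤s z≤n
    ... | no p  | no q  = contradiction inc [ p , q ]

    loop⇒2≤degree : ∀ {g} → g ∈ X → IsLoopAt G g v → 2 ≤ degree G X v
    loop⇒2≤degree {g} g∈X (p , q) = begin
      2                        ≤⟨ twice ⟩
      contribution X v g       ≤⟨ term≤sum _ g ⟩
      sum (contribution X v)   ≡⟨ degree≡sum X v ⟨
      degree G X v             ∎
      where
      open ≤-Reasoning
      twice : 2 ≤ contribution X v g
      twice rewrite []=⇒lookup g∈X with end₁ G g ≟ᶠ v | end₂ G g ≟ᶠ v
      ... | yes _ | yes _ = ≤-refl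
      ... | no ¬p | _     = contradiction p ¬p
      ... | yes _ | no ¬q = contradiction q ¬q

    two-edges⇒2≤degree : ∀ {g h} → g ∈ X → h ∈ X → Inc G g v → Inc G h v → g ≢ h → 2 ≤ degree G X v
    two-edges⇒2≤degree {g} {h} g∈X h∈X incg inch g≢h = begin
      2                                          ≤⟨ +-mono-≤ (contribution-≥1 g∈X incg) (contribution-≥1 h∈X inch) ⟩
      contribution X v g + contribution X v h    ≤⟨ two-terms≤sum _ g≢h ⟩
      sum (contribution X v)                     ≡⟨ degree≡sum X v ⟨
      degree G X v                               ∎
      where open ≤-Reasoning

  -- The function that is 2 on `S` and 0 elsewhere bounds the degree from below, and by `handshake`
  -- its total is no smaller. Hence the two agree at every vertex.
  degrees-tight : ∀ {X S} → (∀ {v} → v ∈ S → 2 ≤ degree G X v) → ∣ X ∣ ≤ ∣ S ∣ →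
    ∀ v → degree G X v ≡ 0 ⊎ degree G X v ≡ 2
  degrees-tight {X} {S} deg≥2 ∣X∣≤∣S∣ v = twice-01 v (sum-tight lower total v)
    where
    open ≤-Reasoning
    twice : Fin n → ℕ
    twice v = indicator (lookup S v) + indicator (lookup S v)
    lower : ∀ v → twice v ≤ degree G X v
    lower v with lookup S v in eq
    ... | true  = deg≥2 (lookup⇒[]= v S eq)
    ... | false = z≤n
    total : sum (degree G X) ≤ sum twice
    total = begin
      sum (degree G X)  ≡⟨ handshake X ⟩
      ∣ X ∣ + ∣ X ∣     ≤⟨ +-mono-≤ ∣X∣≤∣S∣ ∣X∣≤∣S∣ ⟩
      ∣ S ∣ + ∣ S ∣     ≡⟨ cong₂ _+_ (sum-indicator S) (sum-indicator S) ⟨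
      sum (indicator ∘ lookup S) + sum (indicator ∘ lookup S)
                        ≡⟨ ∑-distrib-+ (indicator ∘ lookup S) (indicator ∘ lookup S) ⟨
      sum twice         ∎
    twice-01 : ∀ v → degree G X v ≡ twice v → degree G X v ≡ 0 ⊎ degree G X v ≡ 2
    twice-01 v eq with lookup S v
    ... | true  = inj₂ eq
    ... | false = inj₁ eq

-- Frameworks

module _ (G : Graph n m) (M : Matroid m) (framework : IsFramework G M) where
  open Matroid M

  -- Contrapositive of condition (3): an edge at `w` is not in E(G - w), so if it lay in the closure
  -- it would have to be a loop at `w`.
  pendant∉closure : ∀ {g w} → Inc G g w → ¬ IsLoopAt G g w → ¬ InClosure M g (EdgesAvoiding G w)
  pendant∉closure {g} {w} inc ¬loop g∈cl with x∈p∪q⁻ _ (LoopsAt G w) (proj₁ (proj₂ framework) w g g∈cl)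
  ... | inj₁ g∈avoid = ∈-EdgesAvoiding⁻ G g∈avoid inc
  ... | inj₂ g∈loops = ¬loop (∈-LoopsAt⁻ G g∈loops)

  rank-pendant : ∀ {X} → PendantIncreasing G X rank
  rank-pendant _ inc ¬loop Y⊆ = rank-strict-⊆ M Y⊆ (pendant∉closure inc ¬loop)

  rank-component≤ : ∀ {X u S T} → IsComponentAt G X u S T → rank T ≤ ∣ S ∣
  rank-component≤ = component-grow G rank rank-mono rank-pendant (λ {S} {T} → proj₁ framework _ S T) ⊆⊤

  -- Otherwise g is the only edge of C at w, so it is a coloop of M restricted to C.
  circuit-degree≥2 : ∀ {C w} → Circuit M C → VertexOf G C w → 2 ≤ degree G C w
  circuit-degree≥2 {C} {w} circ (g , g∈C , inc) = decidable-stable (2 ≤? degree G C w) λ deg≱2 →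
    let rest : C ∖ g ⊆ EdgesAvoiding G w
        rest h∈ = ∈-EdgesAvoiding⁺ G λ inch → deg≱2 (two-edges⇒2≤degree G g∈C (p∖x⊆p C g h∈) inc inch
          λ { refl → x∉p∖x C g h∈ })
    in <⇒≱ (rank-circuit< M circ) (begin
      ∣ C ∣                   ≤⟨ ∣p∣≤1+∣p∖x∣ C g ⟩
      suc ∣ C ∖ g ∣           ≡⟨ cong suc (circuit-proper M circ (p∖x⊆p C g) g∈C (x∉p∖x C g)) ⟨
      suc (rank (C ∖ g))      ≤⟨ rank-pendant {⊤} ∈⊤ inc (deg≱2 ∘ loop⇒2≤degree G g∈C) rest ⟩
      rank (C ∖ g ∪ ⁅ g ⁆)    ≤⟨ rank-mono (∪-lub (p∖x⊆p C g) (⁅⁆-⊆ g∈C)) ⟩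
      rank C                  ∎)
    where open ≤-Reasoning

  circuit-at-most-two-components : ∀ {C} → Circuit M C → ∀ {x y z} →
    VertexOf G C x → VertexOf G C y → VertexOf G C z → ¬ Conn G C x y → ¬ Conn G C x z → Conn G C y z
  circuit-at-most-two-components circ x∈ y∈ z∈ x≁y x≁z with proj₂ (proj₂ framework) _ circ _ _ _ x∈ y∈ z∈
  ... | inj₁ x~y        = contradiction x~y x≁y
  ... | inj₂ (inj₁ y~z) = y~z
  ... | inj₂ (inj₂ x~z) = contradiction x~z x≁z

  -- Deleting the vertices of an edge set

  OffVertices : Subset m → Fin m → Set
  OffVertices D g = ¬ VertexOf G D (end₁ G g) × ¬ VertexOf G D (end₂ G g)

  offVertices? : ∀ D → Decidable (OffVertices D)
  offVertices? D g = ¬? (vertexOf? G D _) ×-dec ¬? (vertexOf? G D _)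

  -- The edge set of G - V(D).
  avoiding : Subset m → Subset m
  avoiding D = comprehension (offVertices? D)

  ∈-avoiding : ∀ {D g} → OffVertices D g → g ∈ avoiding D
  ∈-avoiding = ∈-comprehension⁺ (offVertices? _)

  avoiding⇒¬vertexOf : ∀ {D g w} → g ∈ avoiding D → Inc G g w → ¬ VertexOf G D w
  avoiding⇒¬vertexOf g∈ (inj₁ refl) = proj₁ (∈-comprehension⁻ (offVertices? _) g∈)
  avoiding⇒¬vertexOf g∈ (inj₂ refl) = proj₂ (∈-comprehension⁻ (offVertices? _) g∈)

  ¬vertexOf⇒⊆EdgesAvoiding : ∀ {D w} → ¬ VertexOf G D w → D ⊆ EdgesAvoiding G w
  ¬vertexOf⇒⊆EdgesAvoiding w∉D g∈D = ∈-EdgesAvoiding⁺ G λ inc → w∉D (_ , g∈D , inc)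

  -- An end `w` of an edge of G - V(D) is not a vertex of `D`, so `Y ∪ D` still avoids `w` and
  -- condition (3) applies to the union.
  rank-∪-pendant : ∀ D → PendantIncreasing G (avoiding D) (λ Y → rank (Y ∪ D))
  rank-∪-pendant D {Y} {g} g∈ inc ¬loop Y⊆ = ≤-trans
    (rank-strict-⊆ M (∪-lub Y⊆ (¬vertexOf⇒⊆EdgesAvoiding (avoiding⇒¬vertexOf g∈ inc)))
                     (pendant∉closure inc ¬loop))
    (rank-mono (∪-lub (∪-lub (p⊆p∪q D ∘ p⊆p∪q ⁅ g ⁆) (q⊆p∪q _ D)) (p⊆p∪q D ∘ q⊆p∪q Y ⁅ g ⁆)))

  -- A circuit cut into two vertex-disjoint parts, seen from `D₁`. Connectedness is asked of the
  -- first part, and a circuit with two components gives such a record in either order.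
  record Split (D D₁ D₂ : Subset m) : Set where
    field
      circuit   : Circuit M D
      cover     : D ⊆ D₁ ∪ D₂
      sub₁      : D₁ ⊆ D
      sub₂      : D₂ ⊆ D
      ind₁      : Independent M D₁
      ind₂      : Independent M D₂
      disjoint  : ∀ {w} → VertexOf G D₁ w → ¬ VertexOf G D₂ w
      connected : ∀ {x y} → VertexOf G D₁ x → VertexOf G D₁ y → Conn G D₁ x y

  module _ {e : Fin m} {v : Fin n} (loop : IsLoopAt G e v)
           (e∉cl : ¬ InClosure M e (EdgesAvoiding G v)) where

    -- Let T be the component of v in G − V(D₂); it contains e and D₁ and spans some S.
    -- Growing {e} to T gives r(T ∪ D₂) ≥ ∣D₂∣ + ∣S∣, whereas submodularity with the
    -- circuit D gives r(T ∪ D₂) ≤ r(T) + r(D) − r(D₁) < ∣S∣ + ∣D₂∣.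
    split-unreachable : ∀ {D D₁ D₂ x} → Split D D₁ D₂ → ¬ VertexOf G D₂ v →
      VertexOf G D₁ x → ¬ Conn G (avoiding D₂) v x
    split-unreachable {D} {D₁} {D₂} {x} split v∉D₂ x∈D₁ v~x
      with grow G (λ Y → rank (Y ∪ D₂))
                  (λ Y⊆Z → rank-mono (∪-lub (p⊆p∪q D₂ ∘ Y⊆Z) (q⊆p∪q _ D₂))) (rank-∪-pendant D₂)
                  ⁅ v ⁆ ⁅ e ⁆ (x∈⁅x⁆ v)
                  (λ w∈ → subst (Conn G (avoiding D₂) v) (sym (x∈⁅y⁆⇒x≡y v w∈)) here)
                  (⁅⁆-⊆ (∈-avoiding off))
                  (λ g∈ → subst (λ g → end₁ G g ∈ ⁅ v ⁆ × end₂ G g ∈ ⁅ v ⁆) (sym (x∈⁅y⁆⇒x≡y e g∈))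
                                (∈v (proj₁ loop) , ∈v (proj₂ loop)))
      where
      off : OffVertices D₂ e
      off = subst (λ w → ¬ VertexOf G D₂ w) (sym (proj₁ loop)) v∉D₂ ,
            subst (λ w → ¬ VertexOf G D₂ w) (sym (proj₂ loop)) v∉D₂
      ∈v : ∀ {w} → w ≡ v → w ∈ ⁅ v ⁆
      ∈v refl = x∈⁅x⁆ v
    ... | S , T , comp , grown = contradiction bound (n≮n _)
      where
      open Split split
      open ≤-Reasoning
      open +-*-Solver using (solve; _:+_; _:=_)

      D₁⊆T : D₁ ⊆ T
      D₁⊆T {g} g∈D₁ = from (proj₂ comp g)
        ( ∈-avoiding (disjoint (g , g∈D₁ , inj₁ refl) , disjoint (g , g∈D₁ , inj₂ refl))
        , conn-trans G v~x (conn-mono G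
            (λ h∈D₁ → ∈-avoiding (disjoint (_ , h∈D₁ , inj₁ refl) , disjoint (_ , h∈D₁ , inj₂ refl)))
            (connected x∈D₁ (g , g∈D₁ , inj₁ refl))))

      -- The loop pays for the starting vertex: `D₂` avoids `v`, so `e` is outside its closure.
      -- Growing from `v` without an edge would leave `lower` one short.
      e-D₂ : suc ∣ D₂ ∣ ≤ rank (⁅ e ⁆ ∪ D₂)
      e-D₂ = begin
        suc ∣ D₂ ∣          ≡⟨ cong suc ind₂ ⟨
        suc (rank D₂)       ≤⟨ rank-strict-⊆ M (¬vertexOf⇒⊆EdgesAvoiding v∉D₂) e∉cl ⟩
        rank (D₂ ∪ ⁅ e ⁆)   ≤⟨ rank-mono (∪-lub (q⊆p∪q ⁅ e ⁆ D₂) (p⊆p∪q D₂)) ⟩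
        rank (⁅ e ⁆ ∪ D₂)   ∎

      lower : ∣ S ∣ + ∣ D₂ ∣ ≤ rank (T ∪ D₂)
      lower = ≤-pred (begin
        suc (∣ S ∣ + ∣ D₂ ∣)             ≡⟨ +-suc _ _ ⟨
        ∣ S ∣ + suc ∣ D₂ ∣               ≤⟨ +-monoʳ-≤ ∣ S ∣ e-D₂ ⟩
        ∣ S ∣ + rank (⁅ e ⁆ ∪ D₂)        ≤⟨ grown ⟩
        ∣ ⁅ v ⁆ ∣ + rank (T ∪ D₂)        ≡⟨ cong (_+ rank (T ∪ D₂)) (∣⁅x⁆∣≡1 v) ⟩
        suc (rank (T ∪ D₂))              ∎)

      bound : suc (∣ S ∣ + ∣ D₂ ∣ + ∣ D₁ ∣) ≤ ∣ S ∣ + ∣ D₂ ∣ + ∣ D₁ ∣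
      bound = begin
        suc (∣ S ∣ + ∣ D₂ ∣ + ∣ D₁ ∣)    ≤⟨ s≤s (+-monoˡ-≤ ∣ D₁ ∣ lower) ⟩
        suc (rank (T ∪ D₂) + ∣ D₁ ∣)     ≡⟨ cong (λ k → suc (rank (T ∪ D₂) + k)) ind₁ ⟨
        suc (rank (T ∪ D₂) + rank D₁)    ≤⟨ s≤s (submodular M T∪D₂⊆ (∩-glb D₁⊆T sub₁)) ⟩
        suc (rank T + rank D)            ≤⟨ s≤s (+-monoˡ-≤ _ (rank-component≤ comp)) ⟩
        suc (∣ S ∣ + rank D)             ≡⟨ +-suc _ _ ⟨
        ∣ S ∣ + suc (rank D)             ≤⟨ +-monoʳ-≤ ∣ S ∣ (rank-circuit< M circuit) ⟩
        ∣ S ∣ + ∣ D ∣                    ≤⟨ +-monoʳ-≤ ∣ S ∣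
          (≤-trans (p⊆q⇒∣p∣≤∣q∣ cover) (∣p∪q∣≤∣p∣+∣q∣ D₁ D₂)) ⟩
        ∣ S ∣ + (∣ D₁ ∣ + ∣ D₂ ∣)        ≡⟨ solve 3 (λ a b c → a :+ (b :+ c) := a :+ c :+ b) refl (∣ S ∣) (∣ D₁ ∣) (∣ D₂ ∣) ⟩
        ∣ S ∣ + ∣ D₂ ∣ + ∣ D₁ ∣          ∎
        where
        T∪D₂⊆ : T ∪ D₂ ⊆ T ∪ D
        T∪D₂⊆ = ∪-lub (p⊆p∪q D) (q⊆p∪q T D ∘ sub₂)

    -- Here `T` is the component of `x` in `D` and `D₂` the rest, connected by condition (4).
    -- Applying `split-unreachable` in both orders shows, by induction along a walk from `v`, that
    -- no vertex of either part is ever met.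
    disconnected-circuit-unreachable : ∀ {D x y z} → Circuit M D → VertexOf G D x → VertexOf G D y →
      ¬ Conn G D x y → VertexOf G D z → ¬ Conn G ⊤ v z
    disconnected-circuit-unreachable {D} {x} {y} circ x∈D@(gx , gx∈D , incx) (gy , gy∈D , incy) x≁y
      (gz , gz∈D , incz) v~z with component G D x
    ... | S , T , comp =
      [ (λ gz∈T → proj₁ (proj₂ (missed v~z)) (gz , gz∈T , incz))
      , (λ gz∈D₂ → proj₂ (proj₂ (missed v~z)) (gz , gz∈D₂ , incz)) ] (x∈p∪q⁻ T D₂ (cover gz∈D))
      where
      D₂ : Subset m
      D₂ = D ∩ ∁ T

      cover : D ⊆ T ∪ D₂
      cover {g} g∈D with g ∈? T
      ... | yes g∈T = p⊆p∪q _ g∈T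
      ... | no  g∉T = q⊆p∪q _ _ (x∈p∩q⁺ (g∈D , x∉p⇒x∈∁p g∉T))

      T⊆D : T ⊆ D
      T⊆D = component-⊆ G comp

      D₂⊆D : D₂ ⊆ D
      D₂⊆D = p∩q⊆p D (∁ T)

      D₂∉T : ∀ {g} → g ∈ D₂ → g ∉ T
      D₂∉T g∈D₂ = x∈∁p⇒x∉p (p∩q⊆q D (∁ T) g∈D₂)

      inT : ∀ {g w} → g ∈ D → Inc G g w → Conn G D x w → g ∈ T
      inT g∈D inc x~w = from (proj₂ comp _) (g∈D , conn-trans G x~w (conn-sym G (conn-ends G g∈D inc)))

      T~ : ∀ {w} → VertexOf G T w → Conn G D x w
      T~ (g , g∈T , inc) = conn-trans G (proj₂ (to (proj₂ comp g) g∈T)) (conn-ends G (T⊆D g∈T) inc)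

      D₂≁ : ∀ {w} → VertexOf G D₂ w → ¬ Conn G D x w
      D₂≁ (g , g∈D₂ , inc) x~w = D₂∉T g∈D₂ (inT (D₂⊆D g∈D₂) inc x~w)

      conn₁ : ∀ {a b} → VertexOf G T a → VertexOf G T b → Conn G T a b
      conn₁ a∈ b∈ = conn-restrict G
        (λ g∈D a~g → inT g∈D (inj₁ refl) (conn-trans G (T~ a∈) a~g))
        (conn-trans G (conn-sym G (T~ a∈)) (T~ b∈))

      -- Both vertices lie off the component of `x`, so condition (4) joins them in `D`; the walk
      -- cannot enter `T` without reaching that component.
      conn₂ : ∀ {a b} → VertexOf G D₂ a → VertexOf G D₂ b → Conn G D₂ a b
      conn₂ a∈ b∈ = conn-restrict G
        (λ {g} g∈D a~g → x∈p∩q⁺ (g∈D , x∉p⇒x∈∁p λ g∈T →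
          D₂≁ a∈ (conn-trans G (T~ (g , g∈T , inj₁ refl)) (conn-sym G a~g))))
        (circuit-at-most-two-components circ x∈D (vertexOf-mono G D₂⊆D a∈) (vertexOf-mono G D₂⊆D b∈)
          (D₂≁ a∈) (D₂≁ b∈))

      ind₁ : Independent M T
      ind₁ = circuit-proper M circ T⊆D gy∈D λ gy∈T → x≁y (T~ (gy , gy∈T , incy))

      ind₂ : Independent M D₂
      ind₂ = circuit-proper M circ D₂⊆D gx∈D λ gx∈D₂ → D₂∉T gx∈D₂ (inT gx∈D incx here)

      split₁ : Split D T D₂
      split₁ = record
        { circuit = circ ; cover = cover ; sub₁ = T⊆D ; sub₂ = D₂⊆D ; ind₁ = ind₁ ; ind₂ = ind₂
        ; disjoint = λ w∈T w∈D₂ → D₂≁ w∈D₂ (T~ w∈T) ; connected = conn₁ }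

      split₂ : Split D D₂ T
      split₂ = record
        { circuit = circ ; cover = x∈p∪q⁺ ∘ swap ∘ x∈p∪q⁻ T D₂ ∘ cover ; sub₁ = D₂⊆D ; sub₂ = T⊆D
        ; ind₁ = ind₂ ; ind₂ = ind₁
        ; disjoint = λ w∈D₂ w∈T → D₂≁ w∈D₂ (T~ w∈T) ; connected = conn₂ }

      -- The induction invariant. It keeps a walk that is off both parts, because a first hit on one
      -- part must be reached by a walk off the other.
      Missed : Fin n → Set
      Missed w = Conn G (avoiding T ∩ avoiding D₂) v w × ¬ VertexOf G T w × ¬ VertexOf G D₂ w

      -- Base case: if `v` were in a part, the empty walk would already reach it.
      v∉T : ¬ VertexOf G T v
      v∉T v∈T = split-unreachable split₁ (Split.disjoint split₁ v∈T) v∈T here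

      v∉D₂ : ¬ VertexOf G D₂ v
      v∉D₂ v∈D₂ = split-unreachable split₂ (Split.disjoint split₂ v∈D₂) v∈D₂ here

      missed-step : ∀ g {a b} → (∀ {X} → g ∈ X → Conn G X v a → Conn G X v b) →
        (∀ {D} → ¬ VertexOf G D a → ¬ VertexOf G D b → OffVertices D g) → Missed a → Missed b
      missed-step g {a} {b} extend off (v~a , a∉T , a∉D₂) =
        extend (x∈p∩q⁺ (∈-avoiding (off a∉T b∉T) , ∈-avoiding (off a∉D₂ b∉D₂))) v~a , b∉T , b∉D₂
        where
        -- A vertex of `T` is not one of `D₂`, so the new edge is off V(D₂) and the extended walk
        -- contradicts `split-unreachable`.
        b∉T : ¬ VertexOf G T b
        b∉T b∈T = split-unreachable split₁ v∉D₂ b∈T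
          (extend (∈-avoiding (off a∉D₂ (Split.disjoint split₁ b∈T))) (conn-mono G (p∩q⊆q _ _) v~a))
        b∉D₂ : ¬ VertexOf G D₂ b
        b∉D₂ b∈D₂ = split-unreachable split₂ v∉T b∈D₂
          (extend (∈-avoiding (off a∉T (Split.disjoint split₂ b∈D₂))) (conn-mono G (p∩q⊆p _ _) v~a))

      missed : ∀ {w} → Conn G ⊤ v w → Missed w
      missed here        = here , v∉T , v∉D₂
      missed (fwd g _ p) = missed-step g (fwd g) (λ a∉ b∉ → a∉ , b∉) (missed p)
      missed (bwd g _ p) = missed-step g (bwd g) (λ a∉ b∉ → b∉ , a∉) (missed p)

    -- Connectedness of all circuits

    module _ (3-connected : ThreeConnected M) where

      -- An unreachable `g` would make the component of `v` a separation with `k = 1`: it contains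
      -- `e`, its complement contains `g`, and with no circuit crossing the ranks add up to at most
      -- that of `M`.
      all-edges-reachable : ∀ g → Conn G ⊤ v (end₁ G g)
      all-edges-reachable g with component G ⊤ v
      ... | S , T , comp = decidable-stable (conn? G ⊤ v _) λ v≁g →
        3-connected 1 (s≤s z≤n) (s≤s (s≤s z≤n)) T
          ( x∈p⇒1≤∣p∣ (inT e (subst (Conn G ⊤ v) (sym (proj₁ loop)) here))
          , x∈p⇒1≤∣p∣ (x∉p⇒x∈∁p (v≁g ∘ T~))
          , ≤-trans (s≤s (rank-direct-sum M (λ g∈T → x∈p⇒x∉∁p g∈T) sides)) (≤-reflexive (+-comm 1 _)))
        where
        inT : ∀ h → Conn G ⊤ v (end₁ G h) → h ∈ T
        inT h v~h = from (proj₂ comp h) (∈⊤ , v~h)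

        T~ : ∀ {h} → h ∈ T → Conn G ⊤ v (end₁ G h)
        T~ h∈T = proj₂ (to (proj₂ comp _) h∈T)

        sides : ∀ D → Circuit M D → D ⊆ T ⊎ D ⊆ ∁ T
        sides D circ with any? (λ f → f ∈? D ×-dec f ∈? T)
        ... | no none = inj₂ λ f∈D → x∉p⇒x∈∁p λ f∈T → none (_ , f∈D , f∈T)
        -- A circuit with edges on both sides would be disconnected and yet reachable from `v`.
        ... | yes (f , f∈D , f∈T) = inj₁ λ {h} h∈D → decidable-stable (h ∈? T) λ h∉T →
          disconnected-circuit-unreachable circ (f , f∈D , inj₁ refl) (h , h∈D , inj₁ refl)
            (λ f~h → h∉T (inT h (conn-trans G (T~ f∈T) (conn-mono G ⊆⊤ f~h))))
            (f , f∈D , inj₁ refl) (T~ f∈T)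

      circuit-connected : ∀ {D x y} → Circuit M D → VertexOf G D x → VertexOf G D y → Conn G D x y
      circuit-connected {D} {x} {y} circ x∈D@(g , _) y∈D = decidable-stable (conn? G D x y) λ x≁y →
        disconnected-circuit-unreachable circ x∈D y∈D x≁y (g , proj₁ (proj₂ x∈D) , inj₁ refl)
          (all-edges-reachable g)

theorem7p2 : ∀ {n m : ℕ} (G : Graph n m) (M : Matroid m) →
    IsFramework G M → ThreeConnected M → 4 ≤ m →
    ∀ (e : Fin m) (v : Fin n) → IsLoopAt G e v →
    ¬ InClosure M e (EdgesAvoiding G v) →
    ∀ (I : Subset m) →
    Independent M I ⇔ (NoBalancedCycle G M I × ComponentsSparse G M I)
theorem7p2 G M framework 3-connected _ e v loop e∉cl I = mk⇔
  (λ ind →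
    (λ C C⊆I _ circ → proj₁ circ (independent-⊆ M C⊆I ind)) ,
    (λ u S T _ comp → ≤-trans (≤-reflexive (sym (independent-⊆ M (component-⊆ G comp) ind)))
                              (rank-component≤ G M framework comp)))
  (λ (noBalanced , sparse) → decidable-stable (independent? M I) λ dep →
    let C , C⊆I , circ = dependent⇒circuit M I dep
    in noBalanced C C⊆I (sparse-circuit-cycle sparse C⊆I circ) circ)
  where
  -- The connected circuit `C` is a single component with vertex set `S`. Sparsity of `I` descends
  -- to it by `component-grow`, giving `∣ C ∣ ≤ ∣ S ∣`, and minimum degree two then forces every
  -- degree to be 0 or 2.
  sparse-circuit-cycle : ComponentsSparse G M I →
    ∀ {C} → C ⊆ I → Circuit M C → IsCycle G C
  sparse-circuit-cycle sparse {C} C⊆I circ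
    with circuit-nonempty M circ
  ... | f , f∈C with component G C (end₁ G f)
  ... | S , T , comp = (f , f∈C) , (λ _ _ → connected) ,
    degrees-tight G {C} {S} (λ w∈S → circuit-degree≥2 G M framework circ (inC w∈S))
      (≤-trans (p⊆q⇒∣p∣≤∣q∣ C⊆T) (component-grow G ∣_∣ p⊆q⇒∣p∣≤∣q∣ (card-pendant G)
        (λ {S} {T} → sparse _ S T (f , C⊆I f∈C , inj₁ refl)) C⊆I comp))
    where
    connected : ∀ {x y} → VertexOf G C x → VertexOf G C y → Conn G C x y
    connected = circuit-connected G M framework loop e∉cl 3-connected circ
    C⊆T : C ⊆ T
    C⊆T g∈C = from (proj₂ comp _) (g∈C , connected (f , f∈C , inj₁ refl) (_ , g∈C , inj₁ refl))
    inC : ∀ {w} → w ∈ S → VertexOf G C w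
    inC w∈S = conn-vertexOf G (component-conn G comp w∈S) (f , f∈C , inj₁ refl)
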